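{- Let $A\subset\mathbb{R}$ be a set of cardinality seven. Then $|A+A|\le |A-A|$.
   Context: For a finite set $A\subset\mathbb{R}$, $A+A=\{a+b:a,b\in A\}$ and $A-A=\{a-b:a,b\in A\}$ (in both cases $a=b$ is allowed), and $|X|$ denotes the cardinality of a finite set $X$. -}

module Defs where

open import Level using (Level; 0ℓ; _⊔_)
open import Data.Fin using (Fin)
open import Data.Nat as ℕ using (ℕ)
import Data.Nat.Properties as ℕ
open import Data.Product using (Σ; ∃; ∃-syntax; _×_; _,_; proj₁)
open import Data.Rational using (ℚ; 0ℚ; ½; ∣_∣; positive; _<_; -_)
  renaming (_+_ to _+ℚ_; _-_ to _-ℚ_; _*_ to _*ℚ_)
import Data.Rational.Properties as ℚ
open import Data.Rational.Solver using (module +-*-Solver)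
open import Function.Bundles using (Bijection)
open import Relation.Binary.Bundles using (Setoid)
import Relation.Binary.Construct.On as On
open import Relation.Binary.PropositionalEquality
  using (_≡_; refl; sym; trans; cong; subst; setoid)
open import Relation.Unary using (Pred)

open +-*-Solver using (solve; _:+_; _:-_; :-_; _:=_; _:*_; con)

private
  variable
    ℓ ℓ′ : Level

-- The real numbers, as Cauchy sequences of rationals modulo null sequences.
-- The quotient is represented by the equivalence relation _≈_.

IsCauchy : (ℕ → ℚ) → Set
IsCauchy x = ∀ ε → 0ℚ < ε → ∃[ N ] ∀ m n → N ℕ.≤ m → N ℕ.≤ n → ∣ x m -ℚ x n ∣ < ε

record ℝ : Set where
  constructor mkℝ
  field
    seq    : ℕ → ℚ
    cauchy : IsCauchy seq

open ℝ public

infix  4 _≈_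
infixl 6 _+_ _-_

_≈_ : ℝ → ℝ → Set
x ≈ y = ∀ ε → 0ℚ < ε → ∃[ N ] ∀ n → N ℕ.≤ n → ∣ seq x n -ℚ seq y n ∣ < ε

private
  half : ℚ → ℚ
  half ε = ½ *ℚ ε

  0<half : ∀ {ε} → 0ℚ < ε → 0ℚ < half ε
  0<half {ε} 0<ε = subst (_< half ε) (ℚ.*-zeroʳ ½) (ℚ.*-monoʳ-<-pos ½ 0<ε)

  half+half : ∀ ε → half ε +ℚ half ε ≡ ε
  half+half = solve 1 (λ ε → con ½ :* ε :+ con ½ :* ε := ε) refl

  ∣+∣-< : ∀ {p q r ε} → ∣ p ∣ < half ε → ∣ q ∣ < half ε → p +ℚ q ≡ r → ∣ r ∣ < ε
  ∣+∣-< {p} {q} {ε = ε} p< q< refl = ℚ.≤-<-trans (ℚ.∣p+q∣≤∣p∣+∣q∣ p q)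
    (subst (∣ p ∣ +ℚ ∣ q ∣ <_) (half+half ε) (ℚ.+-mono-< p< q<))

  ∣-∣-flip : ∀ p q → ∣ p -ℚ q ∣ ≡ ∣ q -ℚ p ∣
  ∣-∣-flip p q = trans (sym (ℚ.∣-p∣≡∣p∣ (p -ℚ q)))
    (cong ∣_∣ (solve 2 (λ p q → :- (p :- q) := q :- p) refl p q))

_+_ : ℝ → ℝ → ℝ
seq    (x + y) n = seq x n +ℚ seq y n
cauchy (x + y) ε 0<ε with cauchy x (half ε) (0<half 0<ε) | cauchy y (half ε) (0<half 0<ε)
... | M , x-bound | N , y-bound = M ℕ.⊔ N , λ m n ≤m ≤n →
  ∣+∣-<
    (x-bound m n (ℕ.m⊔n≤o⇒m≤o M N ≤m) (ℕ.m⊔n≤o⇒m≤o M N ≤n))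
    (y-bound m n (ℕ.m⊔n≤o⇒n≤o M N ≤m) (ℕ.m⊔n≤o⇒n≤o M N ≤n))
    (solve 4 (λ a b c d → (a :- b) :+ (c :- d) := (a :+ c) :- (b :+ d)) refl
      (seq x m) (seq x n) (seq y m) (seq y n))

_-_ : ℝ → ℝ → ℝ
seq    (x - y) n = seq x n -ℚ seq y n
cauchy (x - y) ε 0<ε with cauchy x (half ε) (0<half 0<ε) | cauchy y (half ε) (0<half 0<ε)
... | M , x-bound | N , y-bound = M ℕ.⊔ N , λ m n ≤m ≤n →
  ∣+∣-<
    (x-bound m n (ℕ.m⊔n≤o⇒m≤o M N ≤m) (ℕ.m⊔n≤o⇒m≤o M N ≤n))
    (y-bound n m (ℕ.m⊔n≤o⇒n≤o M N ≤n) (ℕ.m⊔n≤o⇒n≤o M N ≤m))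
    (solve 4 (λ a b c d → (a :- b) :+ (d :- c) := (a :- c) :- (b :- d)) refl
      (seq x m) (seq x n) (seq y m) (seq y n))

≈-refl : ∀ {x} → x ≈ x
≈-refl {x} ε 0<ε = 0 , λ n _ → subst (λ p → ∣ p ∣ < ε) (sym (ℚ.+-inverseʳ (seq x n))) 0<ε

≈-sym : ∀ {x y} → x ≈ y → y ≈ x
≈-sym {x} {y} x≈y ε 0<ε with x≈y ε 0<ε
... | N , bound = N , λ n ≤n → subst (_< ε) (∣-∣-flip (seq x n) (seq y n)) (bound n ≤n)

≈-trans : ∀ {x y z} → x ≈ y → y ≈ z → x ≈ z
≈-trans {x} {y} {z} x≈y y≈z ε 0<ε with x≈y (half ε) (0<half 0<ε) | y≈z (half ε) (0<half 0<ε)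
... | M , xy-bound | N , yz-bound = M ℕ.⊔ N , λ n ≤n →
  ∣+∣-<
    (xy-bound n (ℕ.m⊔n≤o⇒m≤o M N ≤n))
    (yz-bound n (ℕ.m⊔n≤o⇒n≤o M N ≤n))
    (solve 3 (λ a b c → (a :- b) :+ (b :- c) := a :- c) refl (seq x n) (seq y n) (seq z n))

ℝ-setoid : Setoid 0ℓ 0ℓ
ℝ-setoid = record
  { Carrier       = ℝ
  ; _≈_           = _≈_
  ; isEquivalence = record
    { refl  = λ {x} → ≈-refl {x}
    ; sym   = λ {x} {y} → ≈-sym {x} {y}
    ; trans = λ {x} {y} {z} → ≈-trans {x} {y} {z}
    }
  }

-- Elements of a subset are compared as real numbers; membership proofs are ignored.
subsetSetoid : Pred ℝ ℓ → Setoid ℓ 0ℓ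
subsetSetoid X = On.setoid {B = ∃ X} ℝ-setoid proj₁

-- Cardinality is a relation, because the size of a finite set of reals cannot be
-- computed constructively: X has cardinality n when Fin n is in bijection with X
-- modulo _≈_. For the image of a finite set such an n is unique, and it exists up to
-- double negation, since finitely many equalities of reals may be assumed decided.
HasCardinality : Pred ℝ ℓ → ℕ → Set ℓ
HasCardinality X n = Bijection (setoid (Fin n)) (subsetSetoid X)

infixl 6 _+ₛ_ _-ₛ_

_+ₛ_ : Pred ℝ ℓ → Pred ℝ ℓ′ → Pred ℝ (ℓ ⊔ ℓ′)
(X +ₛ Y) z = ∃[ a ] ∃[ b ] X a × Y b × z ≈ a + b

_-ₛ_ : Pred ℝ ℓ → Pred ℝ ℓ′ → Pred ℝ (ℓ ⊔ ℓ′)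
(X -ₛ Y) z = ∃[ a ] ∃[ b ] X a × Y b × z ≈ a - b

{-# OPTIONS --safe #-}
module Submission where

-- Sort A as a₀ < … < a₆ and look at its 21 positive differences. A strictly increasing chain of
-- k of them yields 2k + 1 distinct elements of A − A (with the negatives and 0), while every
-- coincidence aⱼ − aᵢ = aₗ − aₖ is a coincidence aⱼ + aₖ = aᵢ + aₗ and makes one of the 28 pair
-- sums superfluous; so it suffices that at most 2k + 1 sums are left. Compare well-chosen pairs of
-- differences one after the other, branching three ways, and close what is known under
-- transitivity and under the exchange rule aⱼ − aᵢ < aₗ − aₖ ⇔ aₖ − aᵢ < aₗ − aⱼ. Every branch of
-- the resulting finite tree runs into a contradiction or into the desired inequality; the tree is
-- explored by evaluation. By the symmetry that reverses the order we may assume a₁ − a₀ ≤ a₆ − a₅.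
-- Reals can be compared only up to double negation, which is harmless as m ≤ n is decidable.

open import Defs
open import Data.Nat using (ℕ; _≤_)
open import Relation.Binary.Definitions using (_Respects_)
open import Relation.Unary using (Pred)

open import Algebra.Bundles using (AbelianGroup)
open import Algebra.Core using (Op₂)
import Algebra.Properties.AbelianGroup
import Algebra.Properties.CommutativeSemigroup
import Algebra.Properties.Group
open import Data.Bool using (Bool; true; false; if_then_else_; _∧_; T)
open import Data.Fin using (Fin; zero; suc)
open import Data.Fin.Properties using (injective⇒≤)
open import Data.List using (List; []; _∷_; _++_; length; map; lookup; tabulate; concatMap; upTo)
open import Data.List.Membership.Propositional using (_∈_)
open import Data.List.Membership.Propositional.Properties
  using (∈-concatMap⁺; ∈-lookup; ∈-map⁺; ∈-tabulate⁺; ∈-upTo⁺)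
open import Data.List.Membership.Setoid ℝ-setoid using () renaming (_∈_ to _∈ℝ_)
open import Data.List.Membership.Setoid.Properties using (index-injective)
open import Data.List.Properties using (length-++; length-map; length-tabulate)
open import Data.List.Relation.Binary.Permutation.Propositional
  using (_↭_; ↭-refl; ↭-sym; ↭-trans; prep) renaming (swap to ↭-swap)
open import Data.List.Relation.Binary.Permutation.Propositional.Properties
  using (All-resp-↭; ∈-resp-↭; ↭-length)
open import Data.List.Relation.Binary.Pointwise using (Pointwise; []; _∷_)
open import Data.List.Relation.Unary.All as All using (All; []; _∷_)
import Data.List.Relation.Unary.All.Properties as All
open import Data.List.Relation.Unary.AllPairs as AllPairs using (AllPairs; []; _∷_)
import Data.List.Relation.Unary.AllPairs.Properties as AllPairs
open import Data.List.Relation.Unary.Any as Any using (here; there)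
import Data.List.Relation.Unary.Any.Properties as Any
open import Data.Maybe using (Maybe; just; nothing)
open import Data.Maybe.Relation.Unary.Any as Maybe using (just)
open import Data.Nat as ℕ using (zero; suc; _<_; _∸_; _≡ᵇ_; _<ᵇ_; _≤ᵇ_; _⊔′_; z≤n; s≤s; s≤s⁻¹)
open import Data.Nat.Properties as ℕ
  using (≤-refl; ≤-trans; ≤-total; ≤-<-trans; <-≤-trans; <⇒≤; <-irrefl; _≤?_; _<?_;
         ≡ᵇ⇒≡; ≡⇒≡ᵇ; <ᵇ⇒<; ≤ᵇ⇒≤; +-suc)
open import Data.Product using (∃; ∃-syntax; _×_; _,_; proj₁; proj₂; swap)
open import Data.Rational as ℚ using (ℚ; 0ℚ; ½; ∣_∣)
import Data.Rational.Properties as ℚ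
open import Data.Sum using (_⊎_; inj₁; inj₂; [_,_]′)
open import Data.Unit using (⊤; tt)
open import Function using (_∘_; flip)
open import Function.Bundles using (Bijection)
open import Level using (0ℓ)
open import Relation.Binary.Bundles using (Setoid)
import Relation.Binary.Construct.Flip.EqAndOrd as Flip
open import Relation.Binary.Core using (Rel)
open import Relation.Binary.PropositionalEquality
  using (_≡_; _≢_; refl; sym; trans; cong; cong₂; subst; subst₂; module ≡-Reasoning)
import Relation.Binary.Reasoning.Setoid as ≈-Reasoning
open import Relation.Binary.Structures using (IsStrictPartialOrder)
open import Relation.Nullary using (¬_; Dec; yes; no; contradiction)
open import Relation.Nullary.Decidable using (decidable-stable; toWitness; ¬¬-excluded-middle; _×-dec_)
open import Relation.Nullary.Negation using (¬¬-map)

-- Order on the reals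

module DifferenceIdentities {c ℓ} (G : AbelianGroup c ℓ) where
  open AbelianGroup G renaming (_∙_ to _⊕_; _-_ to _⊝_; _⁻¹ to ⊝_; _≈_ to _≋_; trans to ≋-trans)
  open Algebra.Properties.Group group
  open Algebra.Properties.AbelianGroup G using (⁻¹-∙-comm)
  open Algebra.Properties.CommutativeSemigroup commutativeSemigroup using (interchange)
  open ≈-Reasoning setoid

  neg-minus : ∀ x y → ⊝ (x ⊝ y) ≋ y ⊝ x
  neg-minus = ⁻¹-anti-homo-//

  minus-plus : ∀ x y → (x ⊝ y) ⊕ y ≋ x
  minus-plus x y = //-rightDividesˡ y x

  plus-minus : ∀ x y → (x ⊕ y) ⊝ y ≋ x
  plus-minus x y = //-rightDividesʳ y x

  telescope : ∀ x y z → (x ⊝ y) ⊕ (y ⊝ z) ≋ x ⊝ z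
  telescope x y z = begin
    (x ⊝ y) ⊕ (y ⊝ z)    ≈⟨ assoc x (⊝ y) (y ⊝ z) ⟩
    x ⊕ (⊝ y ⊕ (y ⊝ z))  ≈⟨ ∙-congˡ (\\-leftDividesʳ y (⊝ z)) ⟩
    x ⊝ z                ∎

  minus-plus-minus : ∀ w x y z → (w ⊝ x) ⊝ (y ⊝ z) ≋ (w ⊕ z) ⊝ (x ⊕ y)
  minus-plus-minus w x y z = begin
    (w ⊝ x) ⊝ (y ⊝ z)      ≈⟨ ∙-congˡ (neg-minus y z) ⟩
    (w ⊝ x) ⊕ (z ⊝ y)      ≈⟨ interchange w (⊝ x) z (⊝ y) ⟩
    (w ⊕ z) ⊕ (⊝ x ⊕ ⊝ y)  ≈⟨ ∙-congˡ (⁻¹-∙-comm x y) ⟩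
    (w ⊕ z) ⊝ (x ⊕ y)      ∎

  minus-interchange : ∀ w x y z → (w ⊝ x) ⊝ (y ⊝ z) ≋ (w ⊝ y) ⊝ (x ⊝ z)
  minus-interchange w x y z = begin
    (w ⊝ x) ⊝ (y ⊝ z)  ≈⟨ minus-plus-minus w x y z ⟩
    (w ⊕ z) ⊝ (x ⊕ y)  ≈⟨ ∙-congˡ (⁻¹-cong (comm x y)) ⟩
    (w ⊕ z) ⊝ (y ⊕ x)  ≈⟨ minus-plus-minus w y x z ⟨
    (w ⊝ y) ⊝ (x ⊝ z)  ∎

  minus-swap : ∀ w x y z → (w ⊝ x) ⊝ (y ⊝ z) ≋ (z ⊝ x) ⊝ (y ⊝ w)
  minus-swap w x y z = begin
    (w ⊝ x) ⊝ (y ⊝ z)  ≈⟨ minus-plus-minus w x y z ⟩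
    (w ⊕ z) ⊝ (x ⊕ y)  ≈⟨ ∙-congʳ (comm w z) ⟩
    (z ⊕ w) ⊝ (x ⊕ y)  ≈⟨ minus-plus-minus z x y w ⟨
    (z ⊝ x) ⊝ (y ⊝ w)  ∎

  minus-cancelʳ : ∀ x y z → (x ⊝ z) ⊝ (y ⊝ z) ≋ x ⊝ y
  minus-cancelʳ x y z = ≋-trans (∙-congˡ (neg-minus y z)) (telescope x z y)

  minus-cancelˡ : ∀ x y z → (z ⊝ x) ⊝ (z ⊝ y) ≋ y ⊝ x
  minus-cancelˡ x y z = begin
    (z ⊝ x) ⊝ (z ⊝ y)  ≈⟨ minus-swap z x z y ⟩
    (y ⊝ x) ⊝ (z ⊝ z)  ≈⟨ minus-interchange y x z z ⟩
    (y ⊝ z) ⊝ (x ⊝ z)  ≈⟨ minus-cancelʳ y x z ⟩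
    y ⊝ x              ∎

  plus-minus-plus : ∀ x y z → (x ⊕ z) ⊝ (y ⊕ z) ≋ x ⊝ y
  plus-minus-plus x y z = begin
    (x ⊕ z) ⊝ (y ⊕ z)  ≈⟨ minus-plus-minus x y z z ⟨
    (x ⊝ y) ⊝ (z ⊝ z)  ≈⟨ minus-interchange x y z z ⟩
    (x ⊝ z) ⊝ (y ⊝ z)  ≈⟨ minus-cancelʳ x y z ⟩
    x ⊝ y              ∎

open DifferenceIdentities ℚ.+-0-abelianGroup
open Algebra.Properties.Group ℚ.+-0-group using (⁻¹-involutive)

0<½* : ∀ {ε} → 0ℚ ℚ.< ε → 0ℚ ℚ.< ½ ℚ.* ε
0<½* {ε} 0<ε = subst (ℚ._< ½ ℚ.* ε) (ℚ.*-zeroʳ ½) (ℚ.*-monoʳ-<-pos ½ 0<ε)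

½*+½* : ∀ ε → ½ ℚ.* ε ℚ.+ ½ ℚ.* ε ≡ ε
½*+½* ε = trans (sym (ℚ.*-distribʳ-+ ε ½ ½)) (ℚ.*-identityˡ ε)

p≤∣p∣ : ∀ p → p ℚ.≤ ∣ p ∣
p≤∣p∣ p with ℚ.≤-total 0ℚ p
... | inj₁ 0≤p = ℚ.≤-reflexive (sym (ℚ.0≤p⇒∣p∣≡p 0≤p))
... | inj₂ p≤0 = ℚ.≤-trans p≤0 (ℚ.nonNegative⁻¹ ∣ p ∣ {{ℚ.∣-∣-nonNeg p}})

-p≤∣p∣ : ∀ p → ℚ.- p ℚ.≤ ∣ p ∣
-p≤∣p∣ p = subst (ℚ.- p ℚ.≤_) (ℚ.∣-p∣≡∣p∣ p) (p≤∣p∣ (ℚ.- p))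

∣p∣< : ∀ {p q} → p ℚ.< q → ℚ.- p ℚ.< q → ∣ p ∣ ℚ.< q
∣p∣< {p} {q} p<q -p<q with ℚ.∣p∣≡p∨∣p∣≡-p p
... | inj₁ eq = subst (ℚ._< q) (sym eq) p<q
... | inj₂ eq = subst (ℚ._< q) (sym eq) -p<q

+ℚ-cancelʳ-< : ∀ r {p q} → p ℚ.+ r ℚ.< q ℚ.+ r → p ℚ.< q
+ℚ-cancelʳ-< r {p} {q} p+r<q+r =
  subst₂ ℚ._<_ (plus-minus p r) (plus-minus q r) (ℚ.+-monoˡ-< (ℚ.- r) p+r<q+r)

<∧near⇒< : ∀ {η} p q → η ℚ.+ η ℚ.< p → ∣ p ℚ.- q ∣ ℚ.< η → η ℚ.< q
<∧near⇒< {η} p q 2η<p near = +ℚ-cancelʳ-< (p ℚ.- q) (begin-strict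
  η ℚ.+ (p ℚ.- q)    ≤⟨ ℚ.+-monoʳ-≤ η (p≤∣p∣ (p ℚ.- q)) ⟩
  η ℚ.+ ∣ p ℚ.- q ∣  <⟨ ℚ.+-monoʳ-< η near ⟩
  η ℚ.+ η            <⟨ 2η<p ⟩
  p                  ≡⟨ minus-plus p q ⟨
  (p ℚ.- q) ℚ.+ q    ≡⟨ ℚ.+-comm (p ℚ.- q) q ⟩
  q ℚ.+ (p ℚ.- q)    ∎)
  where open ℚ.≤-Reasoning

≤∧near⇒< : ∀ {η δ} p q → p ℚ.≤ δ → ∣ q ℚ.- p ∣ ℚ.< η → q ℚ.< η ℚ.+ δ
≤∧near⇒< {η} {δ} p q p≤δ near = begin-strict
  q                  ≡⟨ minus-plus q p ⟨
  (q ℚ.- p) ℚ.+ p    ≤⟨ ℚ.+-monoˡ-≤ p (p≤∣p∣ (q ℚ.- p)) ⟩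
  ∣ q ℚ.- p ∣ ℚ.+ p  <⟨ ℚ.+-monoˡ-< p near ⟩
  η ℚ.+ p            ≤⟨ ℚ.+-monoʳ-≤ η p≤δ ⟩
  η ℚ.+ δ            ∎
  where open ℚ.≤-Reasoning

∣-∣-flip : ∀ p q → ∣ p ℚ.- q ∣ ≡ ∣ q ℚ.- p ∣
∣-∣-flip p q = trans (sym (ℚ.∣-p∣≡∣p∣ (p ℚ.- q))) (cong ∣_∣ (neg-minus p q))

infix 4 _<ℝ_

-- One rational gap valid for all large indices, rather than a pointwise inequality, so that the
-- order survives passing to an equivalent sequence.
record _<ℝ_ (x y : ℝ) : Set where
  constructor gap
  field
    size     : ℚ
    0<size   : 0ℚ ℚ.< size
    modulus  : ℕ
    separate : ∀ n → modulus ℕ.≤ n → size ℚ.< seq y n ℚ.- seq x n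

-- Both `_≈_` and `_<ℝ_` see only the pointwise difference of two sequences, so each law of
-- translation reduces to an identity between rationals.
≈-shift : ∀ w x y z → (∀ n → seq w n ℚ.- seq x n ≡ seq y n ℚ.- seq z n) → w ≈ x → y ≈ z
≈-shift _ _ _ _ eq w≈x ε 0<ε with w≈x ε 0<ε
... | N , bound = N , λ n N≤n → subst (λ p → ∣ p ∣ ℚ.< ε) (eq n) (bound n N≤n)

<ℝ-shift : ∀ w x y z → (∀ n → seq x n ℚ.- seq w n ≡ seq z n ℚ.- seq y n) → w <ℝ x → y <ℝ z
<ℝ-shift _ _ _ _ eq (gap ε 0<ε N bound) = gap ε 0<ε N λ n N≤n → subst (ε ℚ.<_) (eq n) (bound n N≤n)

<ℝ-irrefl : ∀ {x y} → x ≈ y → ¬ x <ℝ y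
<ℝ-irrefl {x} {y} x≈y (gap ε 0<ε M x<y) with x≈y ε 0<ε
... | N , near = ℚ.<-irrefl refl (ℚ.<-trans (x<y n (ℕ.m≤m⊔n M N))
    (ℚ.≤-<-trans (subst (ℚ._≤ ∣ seq x n ℚ.- seq y n ∣) (neg-minus (seq x n) (seq y n)) (-p≤∣p∣ _))
      (near n (ℕ.m≤n⊔m M N))))
  where n = M ℕ.⊔ N

<ℝ-trans : ∀ {x y z} → x <ℝ y → y <ℝ z → x <ℝ z
<ℝ-trans {x} {y} {z} (gap ε 0<ε M x<y) (gap δ 0<δ N y<z) = gap ε 0<ε (M ℕ.⊔ N) λ n ≤n →
  subst₂ ℚ._<_ (ℚ.+-identityʳ ε) (telescope (seq z n) (seq y n) (seq x n))
    (subst (ℚ._< _) (ℚ.+-comm 0ℚ ε)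
      (ℚ.+-mono-< (ℚ.<-trans 0<δ (y<z n (ℕ.m⊔n≤o⇒n≤o M N ≤n))) (x<y n (ℕ.m⊔n≤o⇒m≤o M N ≤n))))

<ℝ-respʳ-≈ : ∀ {x y z} → y ≈ z → x <ℝ y → x <ℝ z
<ℝ-respʳ-≈ {x} {y} {z} y≈z (gap ε 0<ε M x<y) with y≈z (½ ℚ.* ε) (0<½* 0<ε)
-- Half of the gap is spent on the distance from `y` to `z`; the other half remains.
... | N , near = gap (½ ℚ.* ε) (0<½* 0<ε) (M ℕ.⊔ N) λ n ≤n → +ℚ-cancelʳ-< (seq y n ℚ.- seq z n)
  (subst (½ ℚ.* ε ℚ.+ (seq y n ℚ.- seq z n) ℚ.<_)
    (trans (sym (telescope (seq y n) (seq z n) (seq x n))) (ℚ.+-comm (seq y n ℚ.- seq z n) (seq z n ℚ.- seq x n)))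
    (ℚ.<-trans (ℚ.+-monoʳ-< (½ ℚ.* ε) (ℚ.≤-<-trans (p≤∣p∣ _) (near n (ℕ.m⊔n≤o⇒n≤o M N ≤n))))
      (subst (ℚ._< seq y n ℚ.- seq x n) (sym (½*+½* ε)) (x<y n (ℕ.m⊔n≤o⇒m≤o M N ≤n)))))

-- Subtraction from `x` reverses the order and so moves the varying argument to the right, where
-- `<ℝ-respʳ-≈` applies.
<ℝ-respˡ-≈ : ∀ {x y z} → y ≈ z → y <ℝ x → z <ℝ x
<ℝ-respˡ-≈ {x} {y} {z} y≈z y<x = <ℝ-shift (x - x) (x - z) z x
  (λ n → minus-cancelˡ (seq z n) (seq x n) (seq x n))
  (<ℝ-respʳ-≈ {x - x} {x - y} {x - z}
    (≈-shift z y (x - y) (x - z)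
      (λ n → sym (minus-cancelˡ (seq y n) (seq z n) (seq x n)))
      (≈-sym {y} {z} y≈z))
    (<ℝ-shift y x (x - x) (x - y)
      (λ n → sym (minus-cancelˡ (seq y n) (seq x n) (seq x n))) y<x))

-- Let η = ε/4 and δ = 2η, and let N be the Cauchy index of `x - y` for η. A value `d N` above δ
-- would keep all later `d n` above η and prove `y <ℝ x`. Hence `d N`, and likewise its negative, is
-- at most δ, and later values stay below η + δ < ε.
≮∧≯⇒≈ : ∀ {x y} → ¬ x <ℝ y → ¬ y <ℝ x → x ≈ y
≮∧≯⇒≈ {x} {y} x≮y y≮x ε 0<ε = N , bound
  where
  δ η : ℚ
  δ = ½ ℚ.* ε
  η = ½ ℚ.* δ
  0<η : 0ℚ ℚ.< η
  0<η = 0<½* (0<½* 0<ε)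
  η+δ<ε : η ℚ.+ δ ℚ.< ε
  η+δ<ε = subst (η ℚ.+ δ ℚ.<_) (½*+½* ε) (ℚ.+-monoˡ-< δ
    (subst₂ ℚ._<_ (ℚ.+-identityʳ η) (½*+½* δ) (ℚ.+-monoʳ-< η 0<η)))
  N : ℕ
  N = proj₁ (cauchy (x - y) η 0<η)
  d : ℕ → ℚ
  d n = seq x n ℚ.- seq y n
  near : ∀ m n → N ℕ.≤ m → N ℕ.≤ n → ∣ d m ℚ.- d n ∣ ℚ.< η
  near = proj₂ (cauchy (x - y) η 0<η)
  near-neg : ∀ m n → N ℕ.≤ m → N ℕ.≤ n → ∣ ℚ.- d m ℚ.- (ℚ.- d n) ∣ ℚ.< η
  near-neg m n N≤m N≤n = subst (ℚ._< η) (trans (∣-∣-flip (d m) (d n)) (cong ∣_∣ (begin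
    d n ℚ.- d m               ≡⟨ ℚ.+-comm (d n) (ℚ.- d m) ⟩
    ℚ.- d m ℚ.+ d n           ≡⟨ cong (ℚ.- d m ℚ.+_) (⁻¹-involutive (d n)) ⟨
    ℚ.- d m ℚ.- (ℚ.- d n)     ∎))) (near m n N≤m N≤n)
    where open ≡-Reasoning
  dN≤δ : d N ℚ.≤ δ
  dN≤δ = ℚ.≮⇒≥ λ δ<dN → y≮x (gap η 0<η N λ n N≤n →
    <∧near⇒< (d N) (d n) (subst (ℚ._< d N) (sym (½*+½* δ)) δ<dN) (near N n ℕ.≤-refl N≤n))
  -dN≤δ : ℚ.- d N ℚ.≤ δ
  -dN≤δ = ℚ.≮⇒≥ λ δ<-dN → x≮y (gap η 0<η N λ n N≤n → subst (η ℚ.<_) (neg-minus (seq x n) (seq y n))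
    (<∧near⇒< (ℚ.- d N) (ℚ.- d n) (subst (ℚ._< ℚ.- d N) (sym (½*+½* δ)) δ<-dN) (near-neg N n ℕ.≤-refl N≤n)))
  bound : ∀ n → N ℕ.≤ n → ∣ d n ∣ ℚ.< ε
  bound n N≤n = ∣p∣<
    (ℚ.<-trans (≤∧near⇒< (d N) (d n) dN≤δ (near n N N≤n ℕ.≤-refl)) η+δ<ε)
    (ℚ.<-trans (≤∧near⇒< (ℚ.- d N) (ℚ.- d n) -dN≤δ (near-neg n N N≤n ℕ.≤-refl)) η+δ<ε)

<ℝ-¬¬-compare : ∀ x y → ¬ ¬ (x <ℝ y ⊎ y <ℝ x ⊎ x ≈ y)
<ℝ-¬¬-compare x y ¬cmp = ¬cmp (inj₂ (inj₂ (≮∧≯⇒≈ {x} {y} (¬cmp ∘ inj₁) (¬cmp ∘ inj₂ ∘ inj₁))))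

-- The axioms of a translation-invariant order, in a form that is literally self-dual.
record IsTranslationOrder {G : Set} (_≋_ _≺_ : Rel G 0ℓ) (_⊕_ _⊖_ : Op₂ G) : Set where
  field
    isStrictPartialOrder : IsStrictPartialOrder _≋_ _≺_
    ¬¬-compare : ∀ x y → ¬ ¬ (x ≺ y ⊎ y ≺ x ⊎ x ≋ y)
    exchange₁  : ∀ {w x y z} → (x ⊖ y) ≺ (z ⊖ w) → (w ⊖ y) ≺ (z ⊖ x)
    exchange₂  : ∀ {w x y z} → (x ⊖ y) ≺ (z ⊖ w) → (x ⊖ z) ≺ (y ⊖ w)
    ⊖-monoˡ    : ∀ {x y} z → x ≺ y → (x ⊖ z) ≺ (y ⊖ z)
    ⊖-monoʳ    : ∀ {x y} z → x ≺ y → (z ⊖ y) ≺ (z ⊖ x)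
    ≋-exchange : ∀ {w x y z} → (x ⊖ y) ≋ (z ⊖ w) → (w ⊖ y) ≋ (z ⊖ x)
    ⊖⇒⊕        : ∀ {w x y z} → (x ⊖ y) ≋ (z ⊖ w) → (z ⊕ y) ≋ (w ⊕ x)
    ⊖-self     : ∀ x y → (x ⊖ x) ≋ (y ⊖ y)
    ⊕-comm     : ∀ x y → (x ⊕ y) ≋ (y ⊕ x)

  open IsStrictPartialOrder isStrictPartialOrder public

+ℝ-comm : ∀ x y → x + y ≈ y + x
+ℝ-comm x y = ≈-shift x x (x + y) (y + x) (λ n →
  trans (ℚ.+-inverseʳ (seq x n)) (sym (trans (cong (ℚ._- (seq y n ℚ.+ seq x n)) (ℚ.+-comm (seq x n) (seq y n)))
    (ℚ.+-inverseʳ (seq y n ℚ.+ seq x n))))) (≈-refl {x})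

+ℝ-congˡ : ∀ x y z → x ≈ y → x + z ≈ y + z
+ℝ-congˡ x y z = ≈-shift x y (x + z) (y + z) (λ n → sym (plus-minus-plus (seq x n) (seq y n) (seq z n)))

+ℝ-cong : ∀ w x y z → w ≈ x → y ≈ z → w + y ≈ x + z
+ℝ-cong w x y z w≈x y≈z = begin
  w + y  ≈⟨ +ℝ-congˡ w x y w≈x ⟩
  x + y  ≈⟨ +ℝ-comm x y ⟩
  y + x  ≈⟨ +ℝ-congˡ y z x y≈z ⟩
  z + x  ≈⟨ +ℝ-comm z x ⟩
  x + z  ∎
  where open ≈-Reasoning ℝ-setoid

<ℝ-isTranslationOrder : IsTranslationOrder _≈_ _<ℝ_ _+_ _-_
<ℝ-isTranslationOrder = record
  { isStrictPartialOrder = record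
    { isEquivalence = Setoid.isEquivalence ℝ-setoid
    ; irrefl        = λ {x} {y} → <ℝ-irrefl {x} {y}
    ; trans         = λ {x} {y} {z} → <ℝ-trans {x} {y} {z}
    ; <-resp-≈      = (λ {x} {y} {z} → <ℝ-respʳ-≈ {x} {y} {z}) , (λ {x} {y} {z} → <ℝ-respˡ-≈ {x} {y} {z})
    }
  ; exchange₁ = λ {w} {x} {y} {z} → <ℝ-shift (x - y) (z - w) (w - y) (z - x) λ n →
      minus-interchange (seq z n) (seq w n) (seq x n) (seq y n)
  ; exchange₂ = λ {w} {x} {y} {z} → <ℝ-shift (x - y) (z - w) (x - z) (y - w) λ n →
      minus-swap (seq z n) (seq w n) (seq x n) (seq y n)
  ; ⊖-monoˡ = λ {x} {y} z → <ℝ-shift x y (x - z) (y - z) λ n →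
      sym (minus-cancelʳ (seq y n) (seq x n) (seq z n))
  ; ⊖-monoʳ = λ {x} {y} z → <ℝ-shift x y (z - y) (z - x) λ n →
      sym (minus-cancelˡ (seq x n) (seq y n) (seq z n))
  ; ≋-exchange = λ {w} {x} {y} {z} → ≈-shift (x - y) (z - w) (w - y) (z - x) λ n →
      minus-swap (seq x n) (seq y n) (seq z n) (seq w n)
  ; ⊖⇒⊕ = λ {w} {x} {y} {z} x-y≈z-w → ≈-shift (z - w) (x - y) (z + y) (w + x) (λ n →
      minus-plus-minus (seq z n) (seq w n) (seq x n) (seq y n))
      (≈-sym {x - y} {z - w} x-y≈z-w)
  ; ⊖-self = λ x y → ≈-shift x x (x - x) (y - y) (λ n →
      trans (sym (minus-cancelʳ (seq x n) (seq x n) (seq y n)))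
        (minus-interchange (seq x n) (seq y n) (seq x n) (seq y n))) (≈-refl {x})
  ; ⊕-comm = +ℝ-comm
  ; ¬¬-compare = <ℝ-¬¬-compare
  }

-- Serves the mirrored case: soundness and counting take the order as a parameter, hence apply to
-- sequences that decrease in ℝ. The two exchange rules trade places.
flip-isTranslationOrder : ∀ {G : Set} {_≋_ _≺_ : Rel G 0ℓ} {_⊕_ _⊖_ : Op₂ G} →
  IsTranslationOrder _≋_ _≺_ _⊕_ _⊖_ → IsTranslationOrder _≋_ (flip _≺_) _⊕_ _⊖_
flip-isTranslationOrder O = record
  { isStrictPartialOrder = Flip.isStrictPartialOrder O.isStrictPartialOrder
  ; exchange₁            = O.exchange₂
  ; exchange₂            = O.exchange₁
  ; ⊖-monoˡ              = O.⊖-monoˡ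
  ; ⊖-monoʳ              = O.⊖-monoʳ
  ; ≋-exchange           = O.≋-exchange
  ; ⊖⇒⊕                  = O.⊖⇒⊕
  ; ⊖-self               = O.⊖-self
  ; ⊕-comm               = O.⊕-comm
  ; ¬¬-compare           = λ x y →
      ¬¬-map [ inj₁ , [ inj₂ ∘ inj₁ , inj₂ ∘ inj₂ ∘ O.Eq.sym ]′ ]′ (O.¬¬-compare y x)
  }
  where module O = IsTranslationOrder O

-- Decision tree

-- (i , j) stands for the difference aⱼ − aᵢ, and in the lists of sums for aᵢ + aⱼ.
Interval : Set
Interval = ℕ × ℕ

_==_ : Interval → Interval → Bool
(i , j) == (k , l) = if i ≡ᵇ k then j ≡ᵇ l else false

-- Knowledge about an ordered pair of differences. A greater difference is recorded as `less` in the
-- transposed entry, and an equality is asserted in both directions.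
data Relationship : Set where
  unknown equal less : Relationship

Fact : Set
Fact = Interval × Relationship × Interval

_⨾_ : Relationship → Relationship → Relationship
unknown ⨾ _       = unknown
_       ⨾ unknown = unknown
equal   ⨾ equal   = equal
_       ⨾ _       = less

-- Tests whether recorded knowledge, on the right, makes a new fact redundant. Discarding facts is
-- always sound, so `less` may absorb `equal` here; clashes are looked for in the transposed entry
-- by `conflicting`.
_⊑_ : Relationship → Relationship → Bool
unknown ⊑ _       = true
equal   ⊑ unknown = false
equal   ⊑ _       = true
less    ⊑ less    = true
less    ⊑ _       = false

conflicting : Relationship → Relationship → Bool
conflicting less equal = true
conflicting less less  = true
conflicting equal less = true
conflicting _ _        = false

Row : Set
Row = List Relationship

Matrix : Set
Matrix = List Row

intervals : List Interval
intervals =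
  (0 , 1) ∷ (1 , 2) ∷ (2 , 3) ∷ (3 , 4) ∷ (4 , 5) ∷ (5 , 6) ∷
  (0 , 2) ∷ (1 , 3) ∷ (2 , 4) ∷ (3 , 5) ∷ (4 , 6) ∷
  (0 , 3) ∷ (1 , 4) ∷ (2 , 5) ∷ (3 , 6) ∷
  (0 , 4) ∷ (1 , 5) ∷ (2 , 6) ∷
  (0 , 5) ∷ (1 , 6) ∷
  (0 , 6) ∷ []

lookupAt : {A : Set} → A → List Interval → List A → Interval → A
lookupAt d (p ∷ ps) (x ∷ xs) q = if p == q then x else lookupAt d ps xs q
lookupAt d _        _        _ = d

entry : Row → Interval → Relationship
entry r = lookupAt unknown intervals r

row : Matrix → Interval → Row
row R = lookupAt (map (λ _ → unknown) intervals) intervals R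

-- Queues the consequence of the exchange rule when both regrouped differences are again positive.
-- For nested or end-sharing intervals at least one of them would be negative or zero.
exchange : Interval → Relationship → Interval → List Fact → List Fact
exchange (i , j) e (k , l) ws =
  if (i <ᵇ k) ∧ (j <ᵇ l) then ((i , k) , e , (j , l)) ∷ ws else
  if (k <ᵇ i) ∧ (l <ᵇ j) then ((l , j) , e , (k , i)) ∷ ws else ws

joinRow : Interval → Relationship → List Interval → Row → Row → List Fact → Row × List Fact
joinRow x t (y ∷ ys) (e ∷ es) (f ∷ fs) ws with joinRow x t ys es fs ws
... | es′ , ws′ with t ⨾ f
... | g = if g ⊑ e then (e ∷ es′ , ws′) else (g ∷ es′ , exchange x g y ws′)
joinRow _ _ _ es _ ws = es , ws

-- Incremental transitive closure: a new fact about `u` and `v` is composed with all that leads to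
-- `u` and all that follows from `v`. The `equal` entries on the diagonal make `u` and `v`
-- themselves part of this. A row that already knows as much about `v` is skipped.
joinRows : Fact → Row → List Interval → Matrix → List Fact → Matrix × List Fact
joinRows (u , s , v) rᵥ (x ∷ xs) (r ∷ rs) ws with joinRows (u , s , v) rᵥ xs rs ws
... | rs′ , ws′ with entry r u ⨾ s
... | t with t ⊑ entry r v
... | true  = r ∷ rs′ , ws′
... | false with joinRow x t intervals r rᵥ ws′
... | r′ , ws″ = r′ ∷ rs′ , ws″
joinRows _ _ _ rs ws = rs , ws

-- `nothing` signals a contradiction; running out of fuel merely loses facts.
saturate : ℕ → Matrix → List Fact → Maybe Matrix
saturate _       R []                  = just R
saturate zero    R _                   = just R
saturate (suc n) R ((u , s , v) ∷ ws) with s ⊑ entry (row R u) v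
... | true  = saturate n R ws
... | false with row R v
... | rᵥ with conflicting s (entry rᵥ u)
... | true  = nothing
... | false with joinRows (u , s , v) rᵥ intervals R ws
... | R′ , ws′ = saturate n R′ ws′

countLess : Row → ℕ
countLess []         = 0
countLess (less ∷ r) = suc (countLess r)
countLess (_ ∷ r)    = countLess r

insertByCount : ℕ × Interval × Row → List (ℕ × Interval × Row) → List (ℕ × Interval × Row)
insertByCount p []       = p ∷ []
insertByCount p (q ∷ qs) = if proj₁ p ≤ᵇ proj₁ q then p ∷ q ∷ qs else q ∷ insertByCount p qs

sortByCount : List Interval → Matrix → List (ℕ × Interval × Row)
sortByCount (x ∷ xs) (r ∷ rs) = insertByCount (countLess r , x , r) (sortByCount xs rs)
sortByCount _        _        = []

maxAbove : Row → List ℕ → ℕ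
maxAbove (less ∷ r) (n ∷ ns) = n ⊔′ maxAbove r ns
maxAbove (_ ∷ r)    (_ ∷ ns) = maxAbove r ns
maxAbove _          _        = 0

setAt : Interval → ℕ → List Interval → List ℕ → List ℕ
setAt q n (p ∷ ps) (m ∷ ms) = if p == q then n ∷ ms else m ∷ setAt q n ps ms
setAt _ _ _        ms       = ms

-- Dynamic programming for the longest chain starting at each interval. A row has more `less`
-- entries than the row of any greater interval, so sorting by their number visits greater
-- intervals first; soundness does not depend on this.
chainLengthFrom : List (ℕ × Interval × Row) → List ℕ → ℕ → ℕ
chainLengthFrom []                 ns m = m
chainLengthFrom ((_ , x , r) ∷ qs) ns m with suc (maxAbove r ns)
... | n = chainLengthFrom qs (setAt x n intervals ns) (m ⊔′ n)

chainLength : Matrix → ℕ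
chainLength R = chainLengthFrom (sortByCount intervals R) (map (λ _ → 0) intervals) 0

remove : Interval → List Interval → List Interval
remove p []       = []
remove p (q ∷ qs) = if p == q then remove p qs else q ∷ remove p qs

-- aⱼ − aᵢ = aₗ − aₖ lets us drop the outer one of the two equal sums aᵢ + aₗ and aⱼ + aₖ.
identify : Interval → Interval → List Interval → List Interval
identify (i , j) (k , l) P =
  if (j <ᵇ l) ∧ (k <ᵇ l) then remove (i , l) P else
  if (l <ᵇ j) ∧ (i <ᵇ j) then remove (k , j) P else P

-- A pair known to be equal counts as settled only once `identify` has nothing left to remove for
-- it. Otherwise it is split once more: both strict branches are contradictory at once, and the
-- third discards the sum.
compared : Matrix → List Interval → Interval → Interval → Bool
compared R P u v with entry (row R u) v | entry (row R v) u
... | less  | _     = true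
... | _     | less  = true
... | equal | equal = length (identify u v P) ≡ᵇ length P
... | _     | _     = false

enough : List Interval → ℕ → Bool
enough P n = length P ≤ᵇ suc (n ℕ.+ n)

search : List (Interval × Interval) → Maybe Matrix → List Interval → Bool
split  : List (Interval × Interval) → Matrix → List Interval → Bool
search qs nothing  P = true
search qs (just R) P = if enough P (chainLength R) then true else split qs R P
split []             R P = false
split ((u , v) ∷ qs) R P =
  if compared R P u v then split qs R P else
  if search qs (saturate 1000 R ((u , less , v) ∷ [])) P then
  if search qs (saturate 1000 R ((v , less , u) ∷ [])) P then
  search qs (saturate 1000 R ((v , equal , u) ∷ (u , equal , v) ∷ [])) (identify u v P)
  else false else false

-- The bound 7 is there because a is only assumed to increase on 0, …, 6.
compareEnds : ℕ → ℕ → Relationship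
compareEnds m n = if m ≡ᵇ n then equal else if (m <ᵇ n) ∧ (n <ᵇ 7) then less else unknown

-- Passes through the intermediate difference aⱼ - aₖ, moving one end at a time; informative only
-- when (i , j) lies inside (k , l).
nested : Interval → Interval → Relationship
nested (i , j) (k , l) = compareEnds k i ⨾ compareEnds j l

initial : Matrix
initial = map (λ x → map (nested x) intervals) intervals

sums : List Interval
sums = concatMap (λ j → map (_, j) (upTo (suc j))) (upTo 7)

-- Soundness of the decision tree

==⇒≡ : ∀ p q → (p == q) ≡ true → p ≡ q
==⇒≡ (i , j) (k , l) eq with i ≡ᵇ k in i≡k
... | true = cong₂ _,_ (≡ᵇ⇒≡ i k (subst T (sym i≡k) tt)) (≡ᵇ⇒≡ j l (subst T (sym eq) tt))

==-refl : ∀ p → (p == p) ≡ true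
==-refl (i , j) with i ≡ᵇ i | ≡⇒≡ᵇ i i refl
... | true | _ = T⇒≡ (≡⇒≡ᵇ j j refl)
  where
  T⇒≡ : ∀ {b} → T b → b ≡ true
  T⇒≡ {true} _ = refl

<ᵇ-true : ∀ {m n} → (m <ᵇ n) ≡ true → m < n
<ᵇ-true {m} {n} eq = <ᵇ⇒< m n (subst T (sym eq) tt)

∧-true : ∀ {b c} → b ∧ c ≡ true → b ≡ true × c ≡ true
∧-true {true} {true} _ = refl , refl

∈-remove : ∀ {q p} P → q ∈ P → q ≢ p → q ∈ remove p P
∈-remove {p = p} (q′ ∷ P) q∈P q≢p with p == q′ in eq
∈-remove {p = p} (q′ ∷ P) (here refl) q≢p | true  = contradiction (sym (==⇒≡ p q′ eq)) q≢p
∈-remove         (q′ ∷ P) (there q∈P) q≢p | true  = ∈-remove P q∈P q≢p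
∈-remove         (q′ ∷ P) (here refl) q≢p | false = here refl
∈-remove         (q′ ∷ P) (there q∈P) q≢p | false = there (∈-remove P q∈P q≢p)

module Soundness {G : Set} {_≋_ _≺_ : Rel G 0ℓ} {_⊕_ _⊖_ : Op₂ G}
  (O : IsTranslationOrder _≋_ _≺_ _⊕_ _⊖_)
  (a : ℕ → G) (a-mono : ∀ {i j} → i < j → j < 7 → a i ≺ a j) where

  open IsTranslationOrder O
    using (exchange₁; exchange₂; ⊖-monoˡ; ⊖-monoʳ; ≋-exchange; ⊖⇒⊕; ⊖-self; ⊕-comm;
           irrefl; <-respˡ-≈; <-respʳ-≈; module Eq)
    renaming (trans to ≺-trans)

  difference : Interval → G
  difference (i , j) = a j ⊖ a i

  total : Interval → G
  total (i , j) = a i ⊕ a j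

  Holds : Interval → Relationship → Interval → Set
  Holds p unknown q = ⊤
  Holds p equal   q = difference p ≋ difference q
  Holds p less    q = difference p ≺ difference q

  From : Interval → Interval → Relationship → Set
  From p q e = Holds p e q

  HoldsFact : Fact → Set
  HoldsFact (p , e , q) = Holds p e q

  RowSound : Interval → Row → Set
  RowSound x = Pointwise (From x) intervals

  MatrixSound : Matrix → Set
  MatrixSound = Pointwise RowSound intervals

  ⨾-sound : ∀ {p q r} e f → Holds p e q → Holds q f r → Holds p (e ⨾ f) r
  ⨾-sound unknown f       _ _ = tt
  ⨾-sound equal   unknown _ _ = tt
  ⨾-sound equal   equal   h k = Eq.trans h k
  ⨾-sound equal   less    h k = <-respˡ-≈ (Eq.sym h) k
  ⨾-sound less    unknown _ _ = tt
  ⨾-sound less    equal   h k = <-respʳ-≈ k h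
  ⨾-sound less    less    h k = ≺-trans h k

  exchange-sound : ∀ p e q {ws} → Holds p e q → All HoldsFact ws → All HoldsFact (exchange p e q ws)
  exchange-sound (i , j) e (k , l) h hs with (i <ᵇ k) ∧ (j <ᵇ l)
  ... | true = inner e h ∷ hs
    where
    inner : ∀ e → Holds (i , j) e (k , l) → Holds (i , k) e (j , l)
    inner unknown h = tt
    inner equal   h = ≋-exchange h
    inner less    h = exchange₁ h
  ... | false with (k <ᵇ i) ∧ (l <ᵇ j)
  ...   | true = inner e h ∷ hs
    where
    inner : ∀ e → Holds (i , j) e (k , l) → Holds (l , j) e (k , i)
    inner unknown h = tt
    inner equal   h = Eq.sym (≋-exchange (Eq.sym h))
    inner less    h = exchange₂ h
  ...   | false = hs

  lookupAt-sound : ∀ {A : Set} {Q : Interval → A → Set} {d} → (∀ q → Q q d) →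
    ∀ {ps xs} → Pointwise Q ps xs → ∀ q → Q q (lookupAt d ps xs q)
  lookupAt-sound d-sound [] q = d-sound q
  lookupAt-sound {Q = Q} d-sound {p ∷ ps} {x ∷ xs} (h ∷ hs) q with p == q in eq
  ... | true  = subst (λ q → Q q x) (==⇒≡ p q eq) h
  ... | false = lookupAt-sound d-sound hs q

  entry-sound : ∀ {x r} → RowSound x r → ∀ q → Holds x (entry r q) q
  entry-sound = lookupAt-sound (λ _ → tt)

  row-sound : ∀ {R} → MatrixSound R → ∀ p → RowSound p (row R p)
  row-sound = lookupAt-sound (λ _ → blank intervals)
    where
    blank : ∀ {p} ps → Pointwise (From p) ps (map (λ _ → unknown) ps)
    blank []       = []
    blank (_ ∷ ps) = tt ∷ blank ps

  joinRow-sound : ∀ {x v} t {ys es fs ws} → Holds x t v →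
    Pointwise (From x) ys es → Pointwise (From v) ys fs → All HoldsFact ws →
    Pointwise (From x) ys (proj₁ (joinRow x t ys es fs ws)) × All HoldsFact (proj₂ (joinRow x t ys es fs ws))
  joinRow-sound t h [] [] hs = [] , hs
  joinRow-sound {x} t {y ∷ ys} {e ∷ es} {f ∷ fs} {ws} h (e-holds ∷ es-hold) (f-holds ∷ fs-hold) hs
    with joinRow x t ys es fs ws | joinRow-sound t h es-hold fs-hold hs
  ... | es′ , ws′ | es′-hold , hs′ with t ⨾ f | ⨾-sound t f h f-holds
  ... | g | g-holds with g ⊑ e
  ... | true  = e-holds ∷ es′-hold , hs′
  ... | false = g-holds ∷ es′-hold , exchange-sound x g y g-holds hs′

  joinRows-sound : ∀ u s v {rᵥ xs rs ws} → Holds u s v → RowSound v rᵥ →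
    Pointwise RowSound xs rs → All HoldsFact ws →
    Pointwise RowSound xs (proj₁ (joinRows (u , s , v) rᵥ xs rs ws)) ×
    All HoldsFact (proj₂ (joinRows (u , s , v) rᵥ xs rs ws))
  joinRows-sound u s v h rᵥ-sound [] hs = [] , hs
  joinRows-sound u s v {rᵥ} {x ∷ xs} {r ∷ rs} {ws} h rᵥ-sound (r-sound ∷ rs-sound) hs
    with joinRows (u , s , v) rᵥ xs rs ws | joinRows-sound u s v h rᵥ-sound rs-sound hs
  ... | rs′ , ws′ | rs′-sound , hs′ with entry r u ⨾ s | ⨾-sound (entry r u) s (entry-sound r-sound u) h
  ... | t | t-holds with t ⊑ entry r v
  ... | true  = r-sound ∷ rs′-sound , hs′
  ... | false with joinRow x t intervals r rᵥ ws′ | joinRow-sound t t-holds r-sound rᵥ-sound hs′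
  ... | _ | r′-sound , hs″ = r′-sound ∷ rs′-sound , hs″

  conflicting-sound : ∀ {p q} e f → Holds p e q → Holds q f p → conflicting e f ≢ true
  conflicting-sound equal less  h k _ = irrefl (Eq.sym h) k
  conflicting-sound less  equal h k _ = irrefl (Eq.sym k) h
  conflicting-sound less  less  h k _ = irrefl Eq.refl (≺-trans h k)

  -- `Maybe.Any` asserts that the result is a `just`: for an actual sequence `a` no contradiction
  -- can arise, so branches that end in `nothing` are never entered.
  saturate-sound : ∀ n {R} ws → MatrixSound R → All HoldsFact ws → Maybe.Any MatrixSound (saturate n R ws)
  saturate-sound zero    [] R-sound [] = just R-sound
  saturate-sound (suc n) [] R-sound [] = just R-sound
  saturate-sound zero    (_ ∷ _) R-sound (h ∷ hs) = just R-sound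
  saturate-sound (suc n) {R} ((u , s , v) ∷ ws) R-sound (h ∷ hs) with s ⊑ entry (row R u) v
  ... | true  = saturate-sound n ws R-sound hs
  ... | false with row R v | row-sound R-sound v
  ... | rᵥ | rᵥ-sound with conflicting s (entry rᵥ u) in eq
  ... | true  = contradiction eq (conflicting-sound s (entry rᵥ u) h (entry-sound rᵥ-sound u))
  ... | false with joinRows (u , s , v) rᵥ intervals R ws | joinRows-sound u s v h rᵥ-sound R-sound hs
  ... | _ , ws′ | R′-sound , hs′ = saturate-sound n ws′ R′-sound hs′

  -- Chains of positive differences

  data Ascent (z : G) : ℕ → Set where
    stop : Ascent z 0
    step : ∀ {n} p → z ≺ difference p → Ascent (difference p) n → Ascent z (suc n)

  Proper : Interval → Set
  Proper (i , j) = i < j × j < 7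

  -- Counts `p` itself as the first step. As the start `z` is arbitrary below `p`, the value 0 is
  -- valid for every interval and fills the initial table.
  AscentThrough : Interval → ℕ → Set
  AscentThrough p n = ∀ {z} → z ≺ difference p → Ascent z n

  ⊔′-elim : ∀ (P : ℕ → Set) {m n} → P m → P n → P (m ⊔′ n)
  ⊔′-elim P {m} {n} pm pn with m <ᵇ n
  ... | true  = pn
  ... | false = pm

  maxAbove-sound : ∀ {x ys r ns} → Pointwise (From x) ys r → Pointwise AscentThrough ys ns →
    Ascent (difference x) (maxAbove r ns)
  maxAbove-sound [] [] = stop
  maxAbove-sound {r = less ∷ _} (h ∷ hs) (up ∷ ups) = ⊔′-elim (Ascent _) (up h) (maxAbove-sound hs ups)
  maxAbove-sound {r = equal ∷ _} (h ∷ hs) (up ∷ ups) = maxAbove-sound hs ups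
  maxAbove-sound {r = unknown ∷ _} (h ∷ hs) (up ∷ ups) = maxAbove-sound hs ups

  setAt-sound : ∀ {q n ps ms} → AscentThrough q n → Pointwise AscentThrough ps ms →
    Pointwise AscentThrough ps (setAt q n ps ms)
  setAt-sound up [] = []
  setAt-sound {q} {n} {p ∷ ps} up (u ∷ us) with p == q in eq
  ... | true  = subst (λ q → AscentThrough q n) (sym (==⇒≡ p q eq)) (λ {z} → up {z}) ∷ us
  ... | false = (λ {z} → u {z}) ∷ setAt-sound (λ {z} → up {z}) us

  LabelledRowSound : ℕ × Interval × Row → Set
  LabelledRowSound (_ , x , r) = Proper x × RowSound x r

  insertByCount-sound : ∀ {p qs} → LabelledRowSound p → All LabelledRowSound qs →
    All LabelledRowSound (insertByCount p qs)
  insertByCount-sound h [] = h ∷ []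
  insertByCount-sound {p} {q ∷ qs} h (k ∷ ks) with proj₁ p ≤ᵇ proj₁ q
  ... | true  = h ∷ k ∷ ks
  ... | false = k ∷ insertByCount-sound h ks

  sortByCount-sound : ∀ {xs rs} → All Proper xs → Pointwise RowSound xs rs →
    All LabelledRowSound (sortByCount xs rs)
  sortByCount-sound [] [] = []
  sortByCount-sound (x-proper ∷ xs-proper) (h ∷ hs) =
    insertByCount-sound (x-proper , h) (sortByCount-sound xs-proper hs)

  -- The axioms provide no zero element; `difference (0 , 0)` takes its place, by `⊖-self`.
  0≺ : ∀ {p} → Proper p → difference (0 , 0) ≺ difference p
  0≺ {i , j} (i<j , j<7) = <-respˡ-≈ (⊖-self (a i) (a 0)) (⊖-monoˡ (a i) (a-mono i<j j<7))

  chainLengthFrom-sound : ∀ {qs ns m} → All LabelledRowSound qs → Pointwise AscentThrough intervals ns →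
    Ascent (difference (0 , 0)) m → Ascent (difference (0 , 0)) (chainLengthFrom qs ns m)
  chainLengthFrom-sound [] ups up = up
  chainLengthFrom-sound {(c , x , r) ∷ qs} {ns} ((x-proper , h) ∷ hs) ups up =
    chainLengthFrom-sound hs (setAt-sound (λ {z} → longer {z}) ups)
      (⊔′-elim (Ascent _) up (longer (0≺ x-proper)))
    where
    longer : AscentThrough x (suc (maxAbove r ns))
    longer x≺ = step x x≺ (maxAbove-sound h ups)

  intervals-proper : All Proper intervals
  intervals-proper = toWitness {a? = All.all? (λ p → (proj₁ p <? proj₂ p) ×-dec (proj₂ p <? 7)) intervals} tt

  chainLength-sound : ∀ {R} → MatrixSound R → Ascent (difference (0 , 0)) (chainLength R)
  chainLength-sound h = chainLengthFrom-sound (sortByCount-sound intervals-proper h) (none intervals) stop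
    where
    none : ∀ ps → Pointwise AscentThrough ps (map (λ _ → 0) ps)
    none []       = []
    none (_ ∷ ps) = (λ _ → stop) ∷ none ps

  -- Representatives never end later than what they represent, so dropping the outer one of two
  -- equal sums cannot orphan the inner one.
  Covers : List Interval → Set
  Covers P = ∀ i j → i ≤ j → j < 7 → ∃[ p ] p ∈ P × proj₂ p ≤ j × total (i , j) ≋ total p

  -- Pairs represented by the removed (i , l) pass to the representative of the inner pair. That one
  -- ends no later than max(j , k) < l, so it differs from (i , l) and survives.
  remove-covers : ∀ {P} i l j k → j < l → k < l → total (j , k) ≋ total (i , l) →
    Covers P → Covers (remove (i , l) P)
  remove-covers {P} i l j k j<l k<l eq covers i′ j′ i′≤j′ j′<7 with covers i′ j′ i′≤j′ j′<7
  ... | p , p∈P , p≤j′ , i′j′≋p with p == (i , l) in p==il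
  ...   | false = p , ∈-remove P p∈P p≢il , p≤j′ , i′j′≋p
    where
    p≢il : p ≢ (i , l)
    p≢il p≡il = contradiction (trans (sym p==il) (trans (cong (_== (i , l)) p≡il) (==-refl (i , l)))) λ ()
  ...   | true with ==⇒≡ p (i , l) p==il
  ...     | refl = replacement (≤-total j k)
    where
    Replacement : Set
    Replacement = ∃[ q ] q ∈ remove (i , l) P × proj₂ q ≤ j′ × total (i′ , j′) ≋ total q
    narrower : ∀ {q m} → m < l → proj₂ q ≤ m → q ≢ (i , l)
    narrower m<l q≤m refl = <-irrefl refl (≤-<-trans q≤m m<l)
    via : ∀ j k → j ≤ k → k < l → total (j , k) ≋ total (i , l) → Replacement
    via j k j≤k k<l jk≋il with covers j k j≤k (<-≤-trans k<l (<⇒≤ (≤-<-trans p≤j′ j′<7)))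
    ... | q , q∈P , q≤k , jk≋q =
      q , ∈-remove P q∈P (narrower k<l q≤k) , ≤-trans q≤k (≤-trans (<⇒≤ k<l) p≤j′) ,
      Eq.trans i′j′≋p (Eq.trans (Eq.sym jk≋il) jk≋q)
    replacement : j ≤ k ⊎ k ≤ j → Replacement
    replacement (inj₁ j≤k) = via j k j≤k k<l eq
    replacement (inj₂ k≤j) = via k j k≤j j<l (Eq.trans (⊕-comm (a k) (a j)) eq)

  identify-covers : ∀ p q {P} → difference p ≋ difference q → Covers P → Covers (identify p q P)
  identify-covers (i , j) (k , l) h covers with (j <ᵇ l) ∧ (k <ᵇ l) in lt₁
  ... | true = remove-covers i l j k (<ᵇ-true (proj₁ (∧-true lt₁))) (<ᵇ-true (proj₂ (∧-true lt₁)))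
      (Eq.trans (⊕-comm (a j) (a k)) (Eq.trans (Eq.sym (⊖⇒⊕ h)) (⊕-comm (a l) (a i)))) covers
  ... | false with (l <ᵇ j) ∧ (i <ᵇ j) in lt₂
  ...   | true = remove-covers k j l i (<ᵇ-true (proj₁ (∧-true lt₂))) (<ᵇ-true (proj₂ (∧-true lt₂)))
      (⊖⇒⊕ h) covers
  ...   | false = covers

  Comparison : Interval × Interval → Set
  Comparison (u , v) =
    difference u ≺ difference v ⊎ difference v ≺ difference u ⊎ difference u ≋ difference v

  Conclusion : Set
  Conclusion = ∃[ P ] ∃[ n ] Covers P × Ascent (difference (0 , 0)) n × length P ≤ suc (n ℕ.+ n)

  -- Descends along the one path singled out by the comparisons `cs`, updating matrix and cover;
  -- that path can only end in a leaf where few enough sums are left.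
  search-sound : ∀ {qs M P} → All Comparison qs → Maybe.Any MatrixSound M → Covers P →
    search qs M P ≡ true → Conclusion
  split-sound  : ∀ {qs R P} → All Comparison qs → MatrixSound R → Covers P →
    split qs R P ≡ true → Conclusion
  search-sound {qs} {just R} {P} cs (just h) covers found with enough P (chainLength R) in fits
  ... | true  = P , chainLength R , covers , chainLength-sound h , ≤ᵇ⇒≤ _ _ (subst T (sym fits) tt)
  ... | false = split-sound cs h covers found
  split-sound {(u , v) ∷ qs} {R} {P} (c ∷ cs) h covers found with compared R P u v
  ... | true = split-sound cs h covers found
  ... | false with search qs (saturate 1000 R ((u , less , v) ∷ [])) P in found₁
  ... | true with search qs (saturate 1000 R ((v , less , u) ∷ [])) P in found₂
  ... | true with c
  ...   | inj₁ u≺v        = search-sound cs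
      (saturate-sound 1000 ((u , less , v) ∷ []) h (u≺v ∷ [])) covers found₁
  ...   | inj₂ (inj₁ v≺u) = search-sound cs
      (saturate-sound 1000 ((v , less , u) ∷ []) h (v≺u ∷ [])) covers found₂
  ...   | inj₂ (inj₂ u≋v) = search-sound cs
      (saturate-sound 1000 ((v , equal , u) ∷ (u , equal , v) ∷ []) h (Eq.sym u≋v ∷ u≋v ∷ []))
      (identify-covers u v u≋v covers) found

  compareEnds-cases : ∀ m n →
    (compareEnds m n ≡ unknown) ⊎ (compareEnds m n ≡ equal × m ≡ n) ⊎
    (compareEnds m n ≡ less × m < n × n < 7)
  compareEnds-cases m n with m ≡ᵇ n in eq
  ... | true = inj₂ (inj₁ (refl , ≡ᵇ⇒≡ m n (subst T (sym eq) tt)))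
  ... | false with (m <ᵇ n) ∧ (n <ᵇ 7) in lt
  ...   | true = inj₂ (inj₂ (refl , <ᵇ-true (proj₁ (∧-true lt)) , <ᵇ-true (proj₂ (∧-true lt))))
  ...   | false = inj₁ refl

  compareEndsˡ : ∀ k i j → Holds (i , j) (compareEnds k i) (k , j)
  compareEndsˡ k i j with compareEnds k i | compareEnds-cases k i
  ... | _ | inj₁ refl                       = tt
  ... | _ | inj₂ (inj₁ (refl , refl))       = Eq.refl
  ... | _ | inj₂ (inj₂ (refl , k<i , i<7))  = ⊖-monoʳ (a j) (a-mono k<i i<7)

  compareEndsʳ : ∀ k j l → Holds (k , j) (compareEnds j l) (k , l)
  compareEndsʳ k j l with compareEnds j l | compareEnds-cases j l
  ... | _ | inj₁ refl                       = tt
  ... | _ | inj₂ (inj₁ (refl , refl))       = Eq.refl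
  ... | _ | inj₂ (inj₂ (refl , j<l , l<7))  = ⊖-monoˡ (a k) (a-mono j<l l<7)

  initial-sound : MatrixSound initial
  initial-sound = matrix intervals
    where
    entries : ∀ x ys → Pointwise (From x) ys (map (nested x) ys)
    entries x       []             = []
    entries (i , j) ((k , l) ∷ ys) =
      ⨾-sound (compareEnds k i) (compareEnds j l) (compareEndsˡ k i j) (compareEndsʳ k j l) ∷ entries (i , j) ys
    matrix : ∀ xs → Pointwise RowSound xs (map (λ x → map (nested x) intervals) xs)
    matrix []       = []
    matrix (x ∷ xs) = entries x intervals ∷ matrix xs

  _≺ᵈ_ : Rel Interval 0ℓ
  p ≺ᵈ q = difference p ≺ difference q

  -- A swapped interval stands for the negative difference, and two exchanges in succession negate
  -- an inequality.
  swap-anti : ∀ p q → p ≺ᵈ q → swap q ≺ᵈ swap p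
  swap-anti _ _ h = exchange₂ (exchange₁ h)

  ascending : ∀ {z n} → Ascent z n →
    ∃[ L ] length L ≡ n × All (λ p → z ≺ difference p) L × AllPairs _≺ᵈ_ L
  ascending stop = [] , refl , [] , []
  ascending (step p z≺p up) with ascending up
  ... | L , refl , p≺L , L-ascending =
    p ∷ L , refl , z≺p ∷ All.map (≺-trans z≺p) p≺L , p≺L ∷ L-ascending

  Apart : Rel Interval 0ℓ
  Apart p q = p ≺ᵈ q ⊎ q ≺ᵈ p

  -- Negatives, zero, positives. `map swap L` runs downwards, so the list is not monotone as a
  -- whole; the symmetric relation `Apart` still tells its members apart.
  symmetric-chain : ∀ {n} → Ascent (difference (0 , 0)) n →
    ∃[ L ] length L ≡ suc (n ℕ.+ n) × AllPairs Apart L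
  symmetric-chain up with ascending up
  ... | L , refl , 0≺L , L-ascending = map swap L ++ (0 , 0) ∷ L , length-symmetric , AllPairs.++⁺
    (AllPairs.map⁺ (AllPairs.map (λ {p} {q} p≺q → inj₂ (swap-anti p q p≺q)) L-ascending))
    (AllPairs.map inj₁ (0≺L ∷ L-ascending))
    (All.map⁺ (All.map (λ {p} 0≺p →
      inj₁ (negative p 0≺p) ∷ All.map (λ 0≺q → inj₁ (≺-trans (negative p 0≺p) 0≺q)) 0≺L) 0≺L))
    where
    negative : ∀ p → (0 , 0) ≺ᵈ p → swap p ≺ᵈ (0 , 0)
    negative p = swap-anti (0 , 0) p
    length-symmetric : length (map swap L ++ (0 , 0) ∷ L) ≡ suc (length L ℕ.+ length L)
    length-symmetric = begin
      length (map swap L ++ (0 , 0) ∷ L)      ≡⟨ length-++ (map swap L) ⟩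
      length (map swap L) ℕ.+ suc (length L)  ≡⟨ cong (ℕ._+ suc (length L)) (length-map swap L) ⟩
      length L ℕ.+ suc (length L)             ≡⟨ +-suc (length L) (length L) ⟩
      suc (length L ℕ.+ length L)             ∎
      where open ≡-Reasoning

  sums-cover : Covers sums
  sums-cover i j i≤j j<7 =
    (i , j) ,
    ∈-concatMap⁺ (λ j → map (_, j) (upTo (suc j)))
      (Any.map (λ { refl → ∈-map⁺ (_, j) (∈-upTo⁺ (s≤s i≤j)) }) (∈-upTo⁺ j<7)) ,
    ≤-refl , Eq.refl

  -- This and reversed-ends are stated over an abstract G so that subtraction of reals stays folded.
  last-gap≺first-gap : (5 , 6) ≺ᵈ (0 , 1) → (a 6 ⊖ a 5) ≺ (a 1 ⊖ a 0)
  last-gap≺first-gap h = h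

-- The order of the comparisons was found by local search; it keeps the two trees below at about
-- 4800 nodes in total.
splits : List (Interval × Interval)
splits =
  ((0 , 2) , (4 , 5)) ∷ ((0 , 1) , (2 , 3)) ∷ ((1 , 4) , (5 , 6)) ∷ ((0 , 2) , (5 , 6)) ∷
  ((0 , 1) , (2 , 4)) ∷ ((0 , 1) , (2 , 5)) ∷ ((1 , 3) , (4 , 5)) ∷ ((0 , 1) , (3 , 5)) ∷
  ((0 , 1) , (4 , 5)) ∷ ((1 , 3) , (5 , 6)) ∷ ((1 , 2) , (5 , 6)) ∷ ((0 , 3) , (5 , 6)) ∷
  ((1 , 2) , (4 , 5)) ∷ ((0 , 1) , (1 , 4)) ∷ ((0 , 2) , (3 , 5)) ∷ ((0 , 1) , (3 , 4)) ∷
  ((1 , 2) , (3 , 5)) ∷ ((2 , 3) , (4 , 5)) ∷ ((0 , 1) , (1 , 3)) ∷ ((4 , 5) , (5 , 6)) ∷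
  ((0 , 1) , (1 , 2)) ∷ ((0 , 4) , (5 , 6)) ∷ ((0 , 2) , (3 , 4)) ∷ ((1 , 5) , (5 , 6)) ∷
  ((3 , 5) , (5 , 6)) ∷ ((1 , 2) , (3 , 4)) ∷ ((3 , 4) , (4 , 5)) ∷ ((3 , 4) , (5 , 6)) ∷
  ((2 , 5) , (5 , 6)) ∷ ((2 , 4) , (5 , 6)) ∷ ((0 , 1) , (1 , 5)) ∷ ((2 , 3) , (5 , 6)) ∷
  ((1 , 3) , (4 , 6)) ∷ ((2 , 3) , (4 , 6)) ∷ ((1 , 2) , (4 , 6)) ∷ ((1 , 2) , (2 , 4)) ∷
  ((2 , 4) , (4 , 5)) ∷ ((1 , 2) , (2 , 3)) ∷ ((1 , 3) , (3 , 4)) ∷ ((2 , 3) , (3 , 4)) ∷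
  ((0 , 2) , (2 , 4)) ∷ ((0 , 2) , (2 , 3)) ∷ ((2 , 4) , (4 , 6)) ∷ ((0 , 2) , (2 , 5)) ∷
  ((1 , 4) , (4 , 5)) ∷ ((2 , 3) , (3 , 5)) ∷ ((0 , 3) , (3 , 4)) ∷ ((3 , 4) , (4 , 6)) ∷
  ((0 , 3) , (4 , 6)) ∷ ((2 , 3) , (3 , 6)) ∷ ((1 , 4) , (4 , 6)) ∷ ((1 , 2) , (3 , 6)) ∷
  ((1 , 3) , (3 , 6)) ∷ ((0 , 2) , (4 , 6)) ∷ ((1 , 3) , (3 , 5)) ∷ ((0 , 3) , (3 , 5)) ∷
  ((1 , 2) , (2 , 5)) ∷ []

-- The root of the search compares the two end gaps. Two cases remain, the third being removed by
-- reversal; in the case of equality a₀ + a₆ = a₁ + a₅ saves one sum at the outset.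
lessFacts equalFacts : List Fact
lessFacts  = ((0 , 1) , less , (5 , 6)) ∷ []
equalFacts = ((0 , 1) , equal , (5 , 6)) ∷ ((5 , 6) , equal , (0 , 1)) ∷ []

lessMatrix equalMatrix : Maybe Matrix
lessMatrix  = saturate 1000 initial lessFacts
equalMatrix = saturate 1000 initial equalFacts

equalSums : List Interval
equalSums = identify (0 , 1) (5 , 6) sums

search-less : search splits lessMatrix sums ≡ true
search-less = refl

search-equal : search splits equalMatrix equalSums ≡ true
search-equal = refl

-- Counting

-- Allows all comparisons in the tree to be assumed at once, there being finitely many.
¬¬-All : ∀ {A : Set} {P : A → Set} → (∀ x → ¬ ¬ P x) → ∀ xs → ¬ ¬ All P xs
¬¬-All ¬¬p []       ¬all = ¬all []
¬¬-All ¬¬p (x ∷ xs) ¬all = ¬¬p x λ px → ¬¬-All ¬¬p xs λ pxs → ¬all (px ∷ pxs)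

lookup-injective : ∀ {A B : Set} (f : A → B) {xs} → AllPairs (λ x y → f x ≢ f y) xs →
  ∀ {i j} → f (lookup xs i) ≡ f (lookup xs j) → i ≡ j
lookup-injective f (x≢ ∷ xs≢) {zero}  {zero}  eq = refl
lookup-injective f {x ∷ xs} (x≢ ∷ xs≢) {zero}  {suc j} eq =
  contradiction eq (All.lookup x≢ (∈-lookup {xs = xs} j))
lookup-injective f {x ∷ xs} (x≢ ∷ xs≢) {suc i} {zero}  eq =
  contradiction (sym eq) (All.lookup x≢ (∈-lookup {xs = xs} i))
lookup-injective f (x≢ ∷ xs≢) {suc i} {suc j} eq = cong suc (lookup-injective f xs≢ eq)

module Enumerated {ℓ} (A : Pred ℝ ℓ) {_≺_ : Rel ℝ 0ℓ} (O : IsTranslationOrder _≈_ _≺_ _+_ _-_)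
  (a : ℕ → ℝ) (a-mono : ∀ {i j} → i < j → j < 7 → a i ≺ a j)
  (a-in : ∀ i → A (a i)) (a-onto : ∀ x → A x → ∃[ i ] i < 7 × x ≈ a i) where

  open IsTranslationOrder O using (irrefl; ¬¬-compare)
  open Soundness O a a-mono

  module _ {m} (C : HasCardinality (A +ₛ A) m) where
    open Bijection C

    -- Each element of A + A is some aⱼ + aₖ, hence equal to a listed total. Elements sent to the
    -- same index of that list are equal reals, so the index map from `Fin m` is injective.
    cover-bound : ∀ {P} → Covers P → m ≤ length P
    cover-bound {P} covers = subst (m ≤_) (length-map total P)
      (injective⇒≤ {f = λ i → Any.index (represented i)} λ {i} {j} eq →
        injective {i} {j} (index-injective ℝ-setoid {proj₁ (to i)} {proj₁ (to j)} {map total P}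
          (represented i) (represented j) eq))
      where
      represent : ∀ z i j → i ≤ j → j < 7 → z ≈ total (i , j) → z ∈ℝ map total P
      represent z i j i≤j j<7 z≈ with covers i j i≤j j<7
      ... | p , p∈P , _ , ≈p =
        Any.map⁺ (Any.map (λ { refl → ≈-trans {z} {total (i , j)} {total p} z≈ ≈p }) p∈P)
      represented : ∀ i → proj₁ (to i) ∈ℝ map total P
      represented i with to i
      ... | z , x , y , Ax , Ay , z≈x+y with a-onto x Ax | a-onto y Ay
      ...   | j , j<7 , x≈ | k , k<7 , y≈ with ≤-total j k
      ...     | inj₁ j≤k = represent z j k j≤k k<7
        (≈-trans {z} {x + y} {a j + a k} z≈x+y (+ℝ-cong x (a j) y (a k) x≈ y≈))
      ...     | inj₂ k≤j = represent z k j k≤j j<7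
        (≈-trans {z} {x + y} {a k + a j} z≈x+y (≈-trans {x + y} {a j + a k} {a k + a j}
          (+ℝ-cong x (a j) y (a k) x≈ y≈) (+ℝ-comm (a j) (a k))))

  module _ {n} (C : HasCardinality (A -ₛ A) n) where
    private module C = Bijection C

    element : Interval → ∃ (A -ₛ A)
    element (i , j) = difference (i , j) , a j , a i , a-in j , a-in i , ≈-refl {difference (i , j)}

    position : Interval → Fin n
    position p = proj₁ (C.strictlySurjective (element p))

    value : Fin n → ℝ
    value k = proj₁ (C.to k)

    at-position : ∀ p → value (position p) ≈ difference p
    at-position p = proj₂ (C.strictlySurjective (element p))

    position-distinct : ∀ p q → difference p ≺ difference q → position p ≢ position q
    position-distinct p q p≺q eq = irrefl {difference p} {difference q}
      (≈-trans {difference p} {value (position p)} {difference q}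
        (≈-sym {value (position p)} {difference p} (at-position p))
        (subst (λ k → value k ≈ difference q) (sym eq) (at-position q))) p≺q

    apart⇒≢ : ∀ {p q} → Apart p q → position p ≢ position q
    apart⇒≢ {p} {q} (inj₁ p≺q) = position-distinct p q p≺q
    apart⇒≢ {p} {q} (inj₂ q≺p) = position-distinct q p q≺p ∘ sym

    -- The members of the symmetric chain are pairwise apart, so they occupy distinct positions in
    -- the enumeration of A - A.
    ascent-bound : ∀ {k} → Ascent (difference (0 , 0)) k → suc (k ℕ.+ k) ≤ n
    ascent-bound up with symmetric-chain up
    ... | L , length-L , L-apart = subst (_≤ n) length-L
      (injective⇒≤ (lookup-injective position (AllPairs.map apart⇒≢ L-apart)))

  ∣A+A∣≤∣A-A∣ : ¬ ((a 6 - a 5) ≺ (a 1 - a 0)) →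
    ∀ {m n} → HasCardinality (A +ₛ A) m → HasCardinality (A -ₛ A) n → m ≤ n
  ∣A+A∣≤∣A-A∣ ≮ {m} {n} C D = decidable-stable (m ≤? n) λ m≰n →
    ¬¬-All {P = Comparison} (λ (u , v) → ¬¬-compare (difference u) (difference v)) splits λ cs →
    ¬¬-compare (difference (0 , 1)) (difference (5 , 6)) λ
      { (inj₁ lt) → m≰n (bound (search-sound {splits} {lessMatrix} {sums} cs
          (saturate-sound 1000 lessFacts initial-sound (lt ∷ [])) sums-cover search-less))
      ; (inj₂ (inj₁ gt)) → ≮ (last-gap≺first-gap gt)
      ; (inj₂ (inj₂ eq)) → m≰n (bound (search-sound {splits} {equalMatrix} {equalSums} cs
          (saturate-sound 1000 equalFacts initial-sound
            (eq ∷ ≈-sym {difference (0 , 1)} {difference (5 , 6)} eq ∷ []))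
          (identify-covers (0 , 1) (5 , 6) eq sums-cover) search-equal))
      }
    where
    bound : Conclusion → m ≤ n
    bound (P , k , covers , up , P≤) = ≤-trans (cover-bound C covers) (≤-trans P≤ (ascent-bound D up))

-- Sorting the elements of A

module _ {A : Set} where

  -- Made total by a default, because `Soundness` expects a sequence on all of ℕ.
  nth : A → List A → ℕ → A
  nth d []       _       = d
  nth d (x ∷ xs) zero    = x
  nth d (x ∷ xs) (suc i) = nth d xs i

  All-nth : ∀ {ℓ} {P : Pred A ℓ} {d xs} → P d → All P xs → ∀ i → P (nth d xs i)
  All-nth pd []         i       = pd
  All-nth pd (px ∷ pxs) zero    = px
  All-nth pd (px ∷ pxs) (suc i) = All-nth pd pxs i

  lookup-nth : ∀ {P : Pred A 0ℓ} {d xs} → All P xs → ∀ i → i < length xs → P (nth d xs i)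
  lookup-nth (px ∷ pxs) zero    _           = px
  lookup-nth (px ∷ pxs) (suc i) (s≤s i<) = lookup-nth pxs i i<

  AllPairs-nth : ∀ {R : Rel A 0ℓ} {d xs} → AllPairs R xs → ∀ {i j} → i < j → j < length xs →
    R (nth d xs i) (nth d xs j)
  AllPairs-nth (rx ∷ rxs) {zero}  {suc j} _         (s≤s j<) = lookup-nth rx j j<
  AllPairs-nth (rx ∷ rxs) {suc i} {suc j} (s≤s i<j) (s≤s j<) = AllPairs-nth rxs i<j j<

  ∈-nth : ∀ {d x xs} → x ∈ xs → ∃[ i ] i < length xs × x ≡ nth d xs i
  ∈-nth (here refl) = 0 , s≤s z≤n , refl
  ∈-nth (there x∈xs) with ∈-nth x∈xs
  ... | i , i< , eq = suc i , s≤s i< , eq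

module _ {G : Set} {_≋_ _≺_ : Rel G 0ℓ} {_⊕_ _⊖_ : Op₂ G} (O : IsTranslationOrder _≋_ _≺_ _⊕_ _⊖_) where
  open IsTranslationOrder O using (¬¬-compare; module Eq) renaming (trans to ≺-trans)

  -- One step of insertion sort, with comparisons available only up to double negation; distinctness
  -- rules out the case of equality.
  ¬¬-insert : ∀ x ys → All (λ y → ¬ x ≋ y) ys → AllPairs _≺_ ys →
    ¬ ¬ (∃[ zs ] AllPairs _≺_ zs × zs ↭ x ∷ ys)
  ¬¬-insert x [] [] [] ¬z = ¬z (x ∷ [] , [] ∷ [] , ↭-refl)
  ¬¬-insert x (y ∷ ys) (x≉y ∷ x≉ys) (y≺ys ∷ ys-sorted) ¬z = ¬¬-compare x y λ
    { (inj₁ x≺y) → ¬z (x ∷ y ∷ ys , (x≺y ∷ All.map (≺-trans x≺y) y≺ys) ∷ y≺ys ∷ ys-sorted , ↭-refl)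
    ; (inj₂ (inj₁ y≺x)) → ¬¬-insert x ys x≉ys ys-sorted λ (zs , zs-sorted , zs↭) →
        ¬z (y ∷ zs , All-resp-↭ (↭-sym zs↭) (y≺x ∷ y≺ys) ∷ zs-sorted ,
            ↭-trans (prep y zs↭) (↭-swap y x ↭-refl))
    ; (inj₂ (inj₂ x≈y)) → x≉y x≈y
    }

  ¬¬-sort : ∀ xs → AllPairs (λ x y → ¬ x ≋ y) xs → ¬ ¬ (∃[ ys ] AllPairs _≺_ ys × ys ↭ xs)
  ¬¬-sort [] [] ¬y = ¬y ([] , [] , ↭-refl)
  ¬¬-sort (x ∷ xs) (x≉xs ∷ xs-distinct) ¬y = ¬¬-sort xs xs-distinct λ (ys , ys-sorted , ys↭xs) →
    ¬¬-insert x ys (All-resp-↭ (↭-sym ys↭xs) x≉xs) ys-sorted λ (zs , zs-sorted , zs↭) →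
      ¬y (zs , zs-sorted , ↭-trans zs↭ (prep x ys↭xs))

  -- The size is a successor so that `x zero` is available as the default of `nth`: it keeps every
  -- `a i` in A, even beyond the end of the list.
  ¬¬-enumerate : ∀ {ℓ k} {A : Pred G ℓ} (x : Fin (suc k) → G) → (∀ {i j} → x i ≋ x j → i ≡ j) →
    (∀ i → A (x i)) → (∀ z → A z → ∃[ i ] x i ≋ z) →
    ¬ ¬ (∃[ a ] (∀ {i j} → i < j → j < suc k → a i ≺ a j) ×
      (∀ i → A (a i)) × (∀ z → A z → ∃[ i ] i < suc k × z ≋ a i))
  ¬¬-enumerate {k = k} {A} x x-injective x-in x-onto ¬a =
    ¬¬-sort (tabulate x) (AllPairs.tabulate⁺ {f = x} (λ i≢j xᵢ≋xⱼ → i≢j (x-injective xᵢ≋xⱼ)))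
      λ (ys , ys-sorted , ys↭) →
    let length-ys : length ys ≡ suc k
        length-ys = trans (↭-length ys↭) (length-tabulate x)
        onto : ∀ z → A z → ∃[ i ] i < suc k × z ≋ nth (x zero) ys i
        onto z Az = let (j , xⱼ≋z) = x-onto z Az
                        (i , i< , eq) = ∈-nth {d = x zero} (∈-resp-↭ (↭-sym ys↭) (∈-tabulate⁺ {f = x} j))
                    in i , subst (i <_) length-ys i< , Eq.trans (Eq.sym xⱼ≋z) (Eq.reflexive eq)
    in ¬a (nth (x zero) ys
      , (λ {i} {j} i<j j< → AllPairs-nth ys-sorted i<j (subst (j <_) (sym length-ys) j<))
      , All-nth {P = A} (x-in zero) (All-resp-↭ (↭-sym ys↭) (All.tabulate⁺ {f = x} x-in))
      , onto)

-- Reversal and conclusion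

reversed-ends : ∀ {G : Set} {_≋_ _≺_ : Rel G 0ℓ} {_⊕_ _⊖_ : Op₂ G} → IsTranslationOrder _≋_ _≺_ _⊕_ _⊖_ →
  ∀ (a b : ℕ → G) → (∀ i → b i ≡ a (6 ∸ i)) → (a 6 ⊖ a 5) ≺ (a 1 ⊖ a 0) → ¬ ((b 1 ⊖ b 0) ≺ (b 6 ⊖ b 5))
-- Negating `h` by two exchanges gives a₀ - a₁ ≺ a₅ - a₆, which is opposite to `h′` after rewriting.
reversed-ends O a b eq h h′ rewrite eq 0 | eq 1 | eq 5 | eq 6 = O.asym (O.exchange₂ (O.exchange₁ h)) h′
  where module O = IsTranslationOrder O

-- If the last gap is the smaller one, i ↦ a (6 ∸ i) increases for the flipped order, runs through
-- the same set and has its end gaps interchanged, so the bound applies to it instead.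
ordered-bound : ∀ {ℓ} (A : Pred ℝ ℓ) (a : ℕ → ℝ) → (∀ {i j} → i < j → j < 7 → a i <ℝ a j) →
  (∀ i → A (a i)) → (∀ z → A z → ∃[ i ] i < 7 × z ≈ a i) → Dec (a 6 - a 5 <ℝ a 1 - a 0) →
  ∀ {m n} → HasCardinality (A +ₛ A) m → HasCardinality (A -ₛ A) n → m ≤ n
ordered-bound A a a-mono a-in a-onto (no ≮) =
  Enumerated.∣A+A∣≤∣A-A∣ A <ℝ-isTranslationOrder a a-mono a-in a-onto ≮
ordered-bound A a a-mono a-in a-onto (yes 56<01) =
  Enumerated.∣A+A∣≤∣A-A∣ A (flip-isTranslationOrder <ℝ-isTranslationOrder) (λ i → a (6 ∸ i)) reversed-mono
    (λ i → a-in (6 ∸ i)) reversed-onto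
    (reversed-ends <ℝ-isTranslationOrder a (λ i → a (6 ∸ i)) (λ _ → refl) 56<01)
  where
  reversed-mono : ∀ {i j} → i < j → j < 7 → a (6 ∸ j) <ℝ a (6 ∸ i)
  reversed-mono {i} i<j j<7 = a-mono (ℕ.∸-monoʳ-< i<j (s≤s⁻¹ j<7)) (s≤s (ℕ.m∸n≤m 6 i))
  reversed-onto : ∀ z → A z → ∃[ i ] i < 7 × z ≈ a (6 ∸ i)
  reversed-onto z Az with a-onto z Az
  ... | i , i<7 , z≈ =
    6 ∸ i , s≤s (ℕ.m∸n≤m 6 i) , subst (λ k → z ≈ a k) (sym (ℕ.m∸[m∸n]≡n (s≤s⁻¹ i<7))) z≈

theorem1p1 : ∀ {ℓ} (A : Pred ℝ ℓ) → A Respects _≈_ → HasCardinality A 7 →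
    ∀ {m n : ℕ} → HasCardinality (A +ₛ A) m → HasCardinality (A -ₛ A) n → m ≤ n
theorem1p1 A _ F {m} {n} C D = decidable-stable (m ≤? n) λ m≰n →
  ¬¬-enumerate <ℝ-isTranslationOrder (proj₁ ∘ F.to) F.injective (proj₂ ∘ F.to)
    (λ z Az → F.strictlySurjective (z , Az))
    λ (a , a-mono , a-in , a-onto) →
  -- Which end gap is smaller cannot be decided for reals in general, but the goal here is a
  -- contradiction, so a decision may be assumed.
  ¬¬-excluded-middle λ cmp → m≰n (ordered-bound A a a-mono a-in a-onto cmp C D)
  where module F = Bijection F
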